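{- Let $p\ge 5$ be a prime and let $a$ be a positive integer such that $\gcd(a,p)=1$. Let $k\ge 3$ be an odd integer such that there exists a positive integer $n_1$ with $n_1>3\log_p(k-1)+\log_p a$ and $v_p\big(s(ap^{n_1},ap^{n_1}-(k-1))\big)<n_1$. Then for any integer $n\ge n_1$, $$v_p(s(ap^{n+1},ap^{n+1}-k))=v_p(s(ap^n,ap^n-k))+2.$$ Furthermore, $v_p(s(ap^{n},ap^{n}-k))=v_p(s(ap^{n_1},ap^{n_1}-k))+2(n-n_1)$ for all $n\ge n_1$.
   Context: For nonnegative integers $n,k$, the (unsigned) Stirling numbers of the first kind $s(n,k)$ are defined by $x(x+1)\cdots(x+n-1)=\sum_{k=0}^n s(n,k)x^k$. $v_p$ denotes the $p$-adic valuation. -}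

module Defs where

open import Data.Nat using (ℕ; zero; suc; _+_; _*_; _^_)
open import Data.Nat.Divisibility using (_∣_)
open import Data.List using (List; []; _∷_)
open import Data.Product using (_×_)
open import Relation.Nullary using (¬_)

-- Polynomials over ℕ as coefficient lists (lowest degree first).
Poly : Set
Poly = List ℕ

_⊕_ : Poly → Poly → Poly
[] ⊕ q = q
(a ∷ p) ⊕ [] = a ∷ p
(a ∷ p) ⊕ (b ∷ q) = (a + b) ∷ (p ⊕ q)

mulXplus : ℕ → Poly → Poly
mulXplus c p = (0 ∷ p) ⊕ Data.List.map (c *_) p
  where import Data.List

rising : ℕ → Poly
rising zero = 1 ∷ []
rising (suc n) = mulXplus n (rising n)

coeff : Poly → ℕ → ℕ
coeff [] _ = 0
coeff (a ∷ p) zero = a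
coeff (a ∷ p) (suc k) = coeff p k

-- unsigned Stirling numbers of the first kind:
-- x(x+1)...(x+n-1) = Σ_k s(n,k) x^k
stirling1 : ℕ → ℕ → ℕ
stirling1 n k = coeff (rising n) k

-- v_p(m) = v  (for m ≠ 0; no v satisfies this when m = 0, i.e. v_p(0) = ∞)
IsVal : ℕ → ℕ → ℕ → Set
IsVal p m v = (p ^ v ∣ m) × (¬ (p ^ suc v ∣ m))

{-# OPTIONS --safe #-}

-- s(N, N-k) is the elementary symmetric polynomial e_k of 0, 1, …, N-1. For odd k the reflection
-- i ↦ N-i gives 2 e_k ≡ N (N-k) e_{k-1} up to terms divisible by p^{2n} p^{v(k)}, where N = a p^n,
-- so v(e_k(N)) = n + v(k) + v(e_{k-1}(N)) as long as v(e_{k-1}(N)) < n. It remains to see that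
-- v(e_m(pN)) = v(e_m(N)) + 1 for m = k-1. Cut the pN factors of ∏ (1 + i t) into p blocks of length N.
-- Since e_i is a ℤ-combination of the binomials C(N, r) with 1 ≤ r ≤ 2i, one has p^n ∣ p^c e_i(N)
-- for some c with p^c ≤ 2i; as m² < p^n, products of two such coefficients with total degree m vanish
-- modulo p^{n+1}. Hence e_m(pN) ≡ p e_m(N) modulo p^{n+1}.
module Submission where

open import Defs
open import Data.Nat.Primality using (Prime; euclidsLemma; prime⇒nonZero; prime⇒nonTrivial)
open import Data.Nat.GCD using (gcd; gcd-greatest)
open import Data.Nat.Divisibility as ℕ∣ using ()
open import Data.Nat.Properties as ℕₚ using ()
open import Data.Product using (_×_; ∃; _,_; proj₁; proj₂)
open import Relation.Nullary using (¬_; yes; no)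
open import Relation.Binary.PropositionalEquality

module _ where

  open import Data.Nat as ℕ using (ℕ; zero; suc; z≤n; s≤s)
  open import Data.Nat.Combinatorics using (_C_; nCk+nC[k+1]≡[n+1]C[k+1]; k>n⇒nCk≡0; nC1≡n)
  open import Data.Nat.Induction using (<-rec)
  open import Data.Nat.Tactic.RingSolver as ℕRing using ()
  open import Data.Integer as ℤ using (ℤ; +_; -_; _+_; _*_; _-_; _^_; 0ℤ; 1ℤ; -1ℤ)
  open import Data.Integer.Properties as ℤₚ using ()
  open import Data.Integer.Divisibility.Signed
  open import Data.Integer.Tactic.RingSolver using (solve-∀)
  open import Data.List using ([]; _∷_; map)
  open import Data.Sum using (_⊎_; inj₁; inj₂)
  open import Data.Empty using (⊥-elim)

  -- Stirling numbers as elementary symmetric polynomials of consecutive integers.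

  -- esym k M x = e_k(x, x+1, …, x+M-1)
  esym : ℕ → ℕ → ℤ → ℤ
  esym zero    M       x = 1ℤ
  esym (suc k) zero    x = 0ℤ
  esym (suc k) (suc M) x = esym (suc k) M x + (x + + M) * esym k M x

  esym-> : ∀ k M x → M ℕ.< k → esym k M x ≡ 0ℤ
  esym-> (suc k) zero    x _         = refl
  esym-> (suc k) (suc M) x (s≤s M<k)
    rewrite esym-> (suc k) M x (ℕₚ.m<n⇒m<1+n M<k) | esym-> k M x M<k =
    trans (ℤₚ.+-identityˡ _) (ℤₚ.*-zeroʳ (x + + M))

  coeff-⊕ : ∀ p q i → coeff (p ⊕ q) i ≡ coeff p i ℕ.+ coeff q i
  coeff-⊕ []      q       i       = refl
  coeff-⊕ (a ∷ p) []      zero    = sym (ℕₚ.+-identityʳ a)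
  coeff-⊕ (a ∷ p) []      (suc i) = sym (ℕₚ.+-identityʳ (coeff p i))
  coeff-⊕ (a ∷ p) (b ∷ q) zero    = refl
  coeff-⊕ (a ∷ p) (b ∷ q) (suc i) = coeff-⊕ p q i

  coeff-map : ∀ c p i → coeff (map (c ℕ.*_) p) i ≡ c ℕ.* coeff p i
  coeff-map c []      i       = sym (ℕₚ.*-zeroʳ c)
  coeff-map c (a ∷ p) zero    = refl
  coeff-map c (a ∷ p) (suc i) = coeff-map c p i

  stirling1-suc : ∀ n k → stirling1 (suc n) (suc k) ≡ stirling1 n k ℕ.+ n ℕ.* stirling1 n (suc k)
  stirling1-suc n k = trans (coeff-⊕ (0 ∷ rising n) (map (n ℕ.*_) (rising n)) (suc k))
    (cong (stirling1 n k ℕ.+_) (coeff-map n (rising n) (suc k)))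

  stirling1-zero : ∀ n → stirling1 (suc n) 0 ≡ 0
  stirling1-zero zero    = refl
  stirling1-zero (suc n) = trans (coeff-⊕ (0 ∷ rising (suc n)) (map (suc n ℕ.*_) (rising (suc n))) 0)
    (trans (coeff-map (suc n) (rising (suc n)) 0)
      (trans (cong (suc n ℕ.*_) (stirling1-zero n)) (ℕₚ.*-zeroʳ (suc n))))

  stirling1-> : ∀ n k → n ℕ.< k → stirling1 n k ≡ 0
  stirling1-> zero    (suc k) _ = refl
  stirling1-> (suc n) (suc k) (s≤s n<k)
    rewrite stirling1-suc n k | stirling1-> n k n<k | stirling1-> n (suc k) (ℕₚ.m<n⇒m<1+n n<k) =
    ℕₚ.*-zeroʳ n

  -- Taking x from j of the j + k factors leaves a product of k of the constants. Writing the length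
  -- as j + k avoids truncated subtraction, and splitting off the last factor then gives the same
  -- recursion on both sides.
  stirling1≡esym : ∀ j k → + stirling1 (j ℕ.+ k) j ≡ esym k (j ℕ.+ k) 0ℤ
  stirling1≡esym zero    zero    = refl
  stirling1≡esym zero    (suc zero) = refl
  -- With j = 0 every factor must contribute its constant, including the constant 0, so both sides
  -- vanish.
  stirling1≡esym zero    (suc (suc k)) = trans (cong +_ (stirling1-zero (suc k))) (sym (begin
    esym (suc (suc k)) (suc k) 0ℤ + (+ suc k) * esym (suc k) (suc k) 0ℤ
      ≡⟨ cong₂ (λ u v → u + (+ suc k) * v) (esym-> (suc (suc k)) (suc k) 0ℤ ℕₚ.≤-refl)
           (sym (stirling1≡esym zero (suc k))) ⟩
    0ℤ + (+ suc k) * (+ stirling1 (suc k) 0)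
      ≡⟨ cong (λ u → 0ℤ + (+ suc k) * (+ u)) (stirling1-zero k) ⟩
    0ℤ + (+ suc k) * 0ℤ
      ≡⟨ trans (ℤₚ.+-identityˡ _) (ℤₚ.*-zeroʳ (+ suc k)) ⟩
    0ℤ ∎))
    where open ≡-Reasoning
  stirling1≡esym (suc j) zero    = trans (cong +_ (stirling1-suc (j ℕ.+ 0) j)) (begin
    + (stirling1 (j ℕ.+ 0) j ℕ.+ (j ℕ.+ 0) ℕ.* stirling1 (j ℕ.+ 0) (suc j))
      ≡⟨ cong (λ u → + (stirling1 (j ℕ.+ 0) j ℕ.+ (j ℕ.+ 0) ℕ.* u)) (stirling1-> (j ℕ.+ 0) (suc j) (s≤s (ℕₚ.≤-reflexive (ℕₚ.+-identityʳ j)))) ⟩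
    + (stirling1 (j ℕ.+ 0) j ℕ.+ (j ℕ.+ 0) ℕ.* 0)
      ≡⟨ cong (λ u → + (stirling1 (j ℕ.+ 0) j ℕ.+ u)) (ℕₚ.*-zeroʳ (j ℕ.+ 0)) ⟩
    + (stirling1 (j ℕ.+ 0) j ℕ.+ 0)
      ≡⟨ cong +_ (ℕₚ.+-identityʳ _) ⟩
    + stirling1 (j ℕ.+ 0) j
      ≡⟨ stirling1≡esym j zero ⟩
    1ℤ ∎)
    where
    open ≡-Reasoning
  stirling1≡esym (suc j) (suc k) = begin
    + stirling1 (suc (j ℕ.+ suc k)) (suc j)
      ≡⟨ cong +_ (stirling1-suc (j ℕ.+ suc k) j) ⟩
    + (stirling1 N j ℕ.+ N ℕ.* stirling1 N (suc j))
      ≡⟨ cong (λ u → + stirling1 N j + u) (ℤₚ.pos-* N _) ⟩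
    + stirling1 N j + + N * + stirling1 N (suc j)
      ≡⟨ cong₂ (λ u v → u + + N * v) (stirling1≡esym j (suc k))
           (subst (λ u → + stirling1 u (suc j) ≡ esym k u 0ℤ) (sym (ℕₚ.+-suc j k)) (stirling1≡esym (suc j) k)) ⟩
    esym (suc k) N 0ℤ + (0ℤ + + N) * esym k N 0ℤ ∎
    where
    open ≡-Reasoning
    N = j ℕ.+ suc k

  stirling1-∸≡esym : ∀ N k → k ℕ.≤ N → + stirling1 N (N ℕ.∸ k) ≡ esym k N 0ℤ
  stirling1-∸≡esym N k k≤N =
    subst (λ M → + stirling1 M (N ℕ.∸ k) ≡ esym k M 0ℤ) (ℕₚ.m∸n+n≡m k≤N) (stirling1≡esym (N ℕ.∸ k) k)

  -- Reversing the order of the variables.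

  -- The recursion of `esym` strips the last variable; reflection reverses the order, so the first
  -- one has to be stripped as well.
  esym-front : ∀ k M x → esym (suc k) (suc M) x ≡ esym (suc k) M (x + 1ℤ) + x * esym k M (x + 1ℤ)
  esym-front zero    zero    x = cong (λ u → 0ℤ + u * 1ℤ) (ℤₚ.+-identityʳ x)
  esym-front (suc k) zero    x = trans (cong (_+_ 0ℤ) (ℤₚ.*-zeroʳ (x + 0ℤ))) (cong (_+_ 0ℤ) (sym (ℤₚ.*-zeroʳ x)))
  esym-front zero    (suc M) x rewrite esym-front zero M x = lemma x (+ M) (esym 1 M (x + 1ℤ))
    where
    lemma : ∀ x m a → (a + x * 1ℤ) + (x + (1ℤ + m)) * 1ℤ ≡ (a + (x + 1ℤ + m) * 1ℤ) + x * 1ℤ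
    lemma = solve-∀
  esym-front (suc k) (suc M) x rewrite esym-front (suc k) M x | esym-front k M x =
    lemma x (+ M) (esym (suc (suc k)) M (x + 1ℤ)) (esym (suc k) M (x + 1ℤ)) (esym k M (x + 1ℤ))
    where
    lemma : ∀ x m a b c → (a + x * b) + (x + (1ℤ + m)) * (b + x * c)
                        ≡ (a + (x + 1ℤ + m) * b) + x * (b + (x + 1ℤ + m) * c)
    lemma = solve-∀

  -- The M consecutive integers starting at 1 - x - M are the negatives of x, ..., x + M - 1 in
  -- reverse order, and e_k is homogeneous of degree k.
  esym-reflect : ∀ k M x → esym k M (1ℤ - x - + M) ≡ -1ℤ ^ k * esym k M x
  esym-reflect zero    M       x = refl
  esym-reflect (suc k) zero    x = sym (ℤₚ.*-zeroʳ (-1ℤ ^ suc k))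
  esym-reflect (suc k) (suc M) x = begin
    esym (suc k) (suc M) y
      ≡⟨ esym-front k M y ⟩
    esym (suc k) M (y + 1ℤ) + y * esym k M (y + 1ℤ)
      ≡⟨ cong (λ z → esym (suc k) M z + y * esym k M z) (shift x (+ M)) ⟩
    esym (suc k) M (1ℤ - x - + M) + y * esym k M (1ℤ - x - + M)
      ≡⟨ cong₂ (λ u v → u + y * v) (esym-reflect (suc k) M x) (esym-reflect k M x) ⟩
    -1ℤ ^ suc k * esym (suc k) M x + y * (-1ℤ ^ k * esym k M x)
      ≡⟨ lemma x (+ M) (-1ℤ ^ k) (esym (suc k) M x) (esym k M x) ⟩
    -1ℤ ^ suc k * esym (suc k) (suc M) x ∎
    where
    open ≡-Reasoning
    y = 1ℤ - x - + suc M
    shift : ∀ x m → 1ℤ - x - (1ℤ + m) + 1ℤ ≡ 1ℤ - x - m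
    shift = solve-∀
    lemma : ∀ x m s a b → (-1ℤ * s) * a + (1ℤ - x - (1ℤ + m)) * (s * b) ≡ (-1ℤ * s) * (a + (x + m) * b)
    lemma = solve-∀

  -- Convolution sums and splitting the variables into two blocks.

  antidiag : (ℕ → ℕ → ℤ) → ℕ → ℤ
  antidiag f zero    = f 0 0
  antidiag f (suc k) = f 0 (suc k) + antidiag (λ j → f (suc j)) k

  antidiag-peelʳ : ∀ f k → antidiag f (suc k) ≡ f (suc k) 0 + antidiag (λ j i → f j (suc i)) k
  antidiag-peelʳ f zero    = ℤₚ.+-comm (f 0 1) (f 1 0)
  antidiag-peelʳ f (suc k) = trans (cong (_+_ (f 0 (suc (suc k)))) (antidiag-peelʳ (λ j → f (suc j)) k))
    (swap (f 0 (suc (suc k))) (f (suc (suc k)) 0) _)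
    where
    swap : ∀ a b c → a + (b + c) ≡ b + (a + c)
    swap = solve-∀

  antidiag-cong : ∀ {f g} → (∀ j i → f j i ≡ g j i) → ∀ k → antidiag f k ≡ antidiag g k
  antidiag-cong f≗g zero    = f≗g 0 0
  antidiag-cong f≗g (suc k) = cong₂ _+_ (f≗g 0 (suc k)) (antidiag-cong (λ j → f≗g (suc j)) k)

  antidiag-+ : ∀ f g k → antidiag (λ j i → f j i + g j i) k ≡ antidiag f k + antidiag g k
  antidiag-+ f g zero    = refl
  antidiag-+ f g (suc k) = trans (cong (_+_ (f 0 (suc k) + g 0 (suc k))) (antidiag-+ (λ j → f (suc j)) (λ j → g (suc j)) k))
    (swap (f 0 (suc k)) (g 0 (suc k)) _ _)
    where
    swap : ∀ a b c d → (a + b) + (c + d) ≡ (a + c) + (b + d)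
    swap = solve-∀

  antidiag-* : ∀ c f k → antidiag (λ j i → c * f j i) k ≡ c * antidiag f k
  antidiag-* c f zero    = refl
  antidiag-* c f (suc k) = trans (cong (_+_ (c * f 0 (suc k))) (antidiag-* c (λ j → f (suc j)) k))
    (sym (ℤₚ.*-distribˡ-+ c (f 0 (suc k)) _))

  shiftˡ shiftʳ : (ℕ → ℕ → ℤ) → ℕ → ℕ → ℤ
  shiftˡ f zero    i = 0ℤ
  shiftˡ f (suc j) i = f j i
  shiftʳ f j zero    = 0ℤ
  shiftʳ f j (suc i) = f j i

  -- In generating functions this is multiplication by 1 + (c + h)t, with the ct part absorbed by
  -- the first index and the ht part by the second. Each shifted sum collapses to `antidiag f k`.
  -- Both the block splitting and the Taylor expansion are inductions with this step.
  antidiag-step : ∀ c h f f′ → (∀ j i → f′ j i ≡ f j i + (c * shiftˡ f j i + h * shiftʳ f j i)) →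
    ∀ k → antidiag f′ (suc k) ≡ antidiag f (suc k) + (c + h) * antidiag f k
  antidiag-step c h f f′ step k = begin
    antidiag f′ (suc k)
      ≡⟨ antidiag-cong step (suc k) ⟩
    antidiag (λ j i → f j i + (c * shiftˡ f j i + h * shiftʳ f j i)) (suc k)
      ≡⟨ antidiag-+ f (λ j i → c * shiftˡ f j i + h * shiftʳ f j i) (suc k) ⟩
    antidiag f (suc k) + antidiag (λ j i → c * shiftˡ f j i + h * shiftʳ f j i) (suc k)
      ≡⟨ cong (_+_ (antidiag f (suc k))) (antidiag-+ (λ j i → c * shiftˡ f j i) (λ j i → h * shiftʳ f j i) (suc k)) ⟩
    antidiag f (suc k) + (antidiag (λ j i → c * shiftˡ f j i) (suc k) + antidiag (λ j i → h * shiftʳ f j i) (suc k))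
      ≡⟨ cong₂ (λ u v → antidiag f (suc k) + (u + v))
           (trans (antidiag-* c (shiftˡ f) (suc k)) (cong (c *_) (ℤₚ.+-identityˡ _)))
           (trans (antidiag-* h (shiftʳ f) (suc k)) (cong (h *_) (trans (antidiag-peelʳ (shiftʳ f) k) (ℤₚ.+-identityˡ _)))) ⟩
    antidiag f (suc k) + (c * antidiag f k + h * antidiag f k)
      ≡⟨ cong (_+_ (antidiag f (suc k))) (sym (ℤₚ.*-distribʳ-+ (antidiag f k) c h)) ⟩
    antidiag f (suc k) + (c + h) * antidiag f k ∎
    where open ≡-Reasoning

  antidiag-zero : ∀ f → (∀ j i → f j (suc i) ≡ 0ℤ) → ∀ k → antidiag f k ≡ f k 0
  antidiag-zero f f≡0 zero    = refl
  antidiag-zero f f≡0 (suc k) = trans (cong₂ _+_ (f≡0 0 k) (antidiag-zero (λ j → f (suc j)) (λ j → f≡0 (suc j)) k))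
    (ℤₚ.+-identityˡ _)

  -- Choose j variables among the first M and i among the next N. Adding a variable to the second
  -- block only affects the second index, hence c = 0 in `antidiag-step`.
  esym-split : ∀ k M N x → esym k (M ℕ.+ N) x ≡ antidiag (λ j i → esym j M x * esym i N (x + + M)) k
  esym-split k M zero x = sym (begin
    antidiag (λ j i → esym j M x * esym i zero (x + + M)) k
      ≡⟨ antidiag-zero _ (λ j i → ℤₚ.*-zeroʳ (esym j M x)) k ⟩
    esym k M x * 1ℤ
      ≡⟨ ℤₚ.*-identityʳ _ ⟩
    esym k M x
      ≡⟨ cong (λ u → esym k u x) (sym (ℕₚ.+-identityʳ M)) ⟩
    esym k (M ℕ.+ 0) x ∎)
    where open ≡-Reasoning
  esym-split zero    M (suc N) x = refl
  esym-split (suc k) M (suc N) x rewrite ℕₚ.+-suc M N = begin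
    esym (suc k) (M ℕ.+ N) x + (x + + (M ℕ.+ N)) * esym k (M ℕ.+ N) x
      ≡⟨ cong₂ (λ u v → u + (x + (+ M + + N)) * v) (esym-split (suc k) M N x) (esym-split k M N x) ⟩
    antidiag f (suc k) + (x + (+ M + + N)) * antidiag f k
      ≡⟨ cong (λ u → antidiag f (suc k) + u * antidiag f k) (assoc x (+ M) (+ N)) ⟩
    antidiag f (suc k) + (0ℤ + (x + + M + + N)) * antidiag f k
      ≡⟨ antidiag-step 0ℤ (x + + M + + N) f _ step k ⟨
    antidiag (λ j i → esym j M x * esym i (suc N) (x + + M)) (suc k) ∎
    where
    open ≡-Reasoning
    f = λ j i → esym j M x * esym i N (x + + M)
    assoc : ∀ x m n → x + (m + n) ≡ 0ℤ + (x + m + n)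
    assoc = solve-∀
    step₀ : ∀ a h s → a ≡ a + (0ℤ * s + h * 0ℤ)
    step₀ = solve-∀
    step₁ : ∀ a b c h s → a * (b + h * c) ≡ a * b + (0ℤ * s + h * (a * c))
    step₁ = solve-∀
    step : ∀ j i → esym j M x * esym i (suc N) (x + + M)
      ≡ f j i + (0ℤ * shiftˡ f j i + (x + + M + + N) * shiftʳ f j i)
    step j zero    = step₀ _ (x + + M + + N) (shiftˡ f j 0)
    step j (suc i) = step₁ (esym j M x) (esym (suc i) N (x + + M)) (esym i N (x + + M)) (x + + M + + N) (shiftˡ f j (suc i))

  -- Binomial identities and the Taylor expansion in the starting point.

  pascal : ∀ n k → + (suc n C suc k) ≡ + (n C k) + + (n C suc k)
  pascal n k = cong +_ (sym (nCk+nC[k+1]≡[n+1]C[k+1] n k))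

  absorption : ∀ n k → + suc k * + (suc n C suc k) ≡ + suc n * + (n C k)
  absorption zero    zero    = refl
  absorption zero    (suc k)
    rewrite k>n⇒nCk≡0 {1} {suc (suc k)} (s≤s (s≤s z≤n)) | k>n⇒nCk≡0 {0} {suc k} (s≤s z≤n) = ℤₚ.*-zeroʳ (+ suc (suc k))
  absorption (suc n) zero    = trans (cong (λ u → 1ℤ * + u) (nC1≡n (suc (suc n))))
    (ℤₚ.*-comm 1ℤ (+ suc (suc n)))
  absorption (suc n) (suc k) = begin
    + suc (suc k) * + (suc (suc n) C suc (suc k))
      ≡⟨ cong (+ suc (suc k) *_) (pascal (suc n) (suc k)) ⟩
    + suc (suc k) * (+ (suc n C suc k) + + (suc n C suc (suc k)))
      ≡⟨ lemma₁ (+ suc k) (+ (suc n C suc k)) _ ⟩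
    (+ suc k * + (suc n C suc k) + + suc (suc k) * + (suc n C suc (suc k))) + + (suc n C suc k)
      ≡⟨ cong₂ (λ u v → (u + v) + + (suc n C suc k)) (absorption n k) (absorption n (suc k)) ⟩
    (+ suc n * + (n C k) + + suc n * + (n C suc k)) + + (suc n C suc k)
      ≡⟨ cong (λ u → (+ suc n * + (n C k) + + suc n * + (n C suc k)) + u) (pascal n k) ⟩
    (+ suc n * + (n C k) + + suc n * + (n C suc k)) + (+ (n C k) + + (n C suc k))
      ≡⟨ lemma₂ (+ suc n) (+ (n C k)) (+ (n C suc k)) ⟩
    + suc (suc n) * (+ (n C k) + + (n C suc k))
      ≡⟨ cong (+ suc (suc n) *_) (pascal n k) ⟨
    + suc (suc n) * + (suc n C suc k) ∎
    where
    open ≡-Reasoning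
    lemma₁ : ∀ k a b → (1ℤ + k) * (a + b) ≡ (k * a + (1ℤ + k) * b) + a
    lemma₁ = solve-∀
    lemma₂ : ∀ n a b → (n * a + n * b) + (a + b) ≡ (1ℤ + n) * (a + b)
    lemma₂ = solve-∀

  [k+1]*nC[k+1]≡[n-k]*nCk : ∀ n k → + suc k * + (n C suc k) ≡ (+ n - + k) * + (n C k)
  [k+1]*nC[k+1]≡[n-k]*nCk n k = begin
    + suc k * + (n C suc k)
      ≡⟨ lemma₁ (+ suc k) (+ (n C k)) (+ (n C suc k)) ⟩
    + suc k * (+ (n C k) + + (n C suc k)) - + suc k * + (n C k)
      ≡⟨ cong (λ u → + suc k * u - + suc k * + (n C k)) (pascal n k) ⟨
    + suc k * + (suc n C suc k) - + suc k * + (n C k)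
      ≡⟨ cong (_- + suc k * + (n C k)) (absorption n k) ⟩
    + suc n * + (n C k) - + suc k * + (n C k)
      ≡⟨ lemma₂ (+ n) (+ k) (+ (n C k)) ⟩
    (+ n - + k) * + (n C k) ∎
    where
    open ≡-Reasoning
    lemma₁ : ∀ k a b → k * b ≡ k * (a + b) - k * a
    lemma₁ = solve-∀
    lemma₂ : ∀ n k a → (1ℤ + n) * a - (1ℤ + k) * a ≡ (n - k) * a
    lemma₂ = solve-∀

  taylorTerm : ℕ → ℤ → ℤ → ℕ → ℕ → ℤ
  taylorTerm M x h j i = esym j M x * (h ^ i * + ((M ℕ.∸ j) C i))

  -- In a product of j + i shifted variables, j of them contribute their old value and i contribute
  -- h. A fixed choice of the j leaves M - j variables from which to pick the i.
  esym-taylor : ∀ k M x h → esym k M (x + h) ≡ antidiag (taylorTerm M x h) k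
  esym-taylor zero    M       x h = refl
  esym-taylor (suc k) zero    x h = sym (cong₂ _+_ first (rest k))
    where
    first : taylorTerm 0 x h 0 (suc k) ≡ 0ℤ
    first rewrite k>n⇒nCk≡0 {0} {suc k} (s≤s z≤n) | ℤₚ.*-zeroʳ (h ^ suc k) = refl
    rest : ∀ k → antidiag (λ j i → 0ℤ) k ≡ 0ℤ
    rest zero    = refl
    rest (suc k) = trans (ℤₚ.+-identityˡ _) (rest k)
  esym-taylor (suc k) (suc M) x h = begin
    esym (suc k) M (x + h) + (x + h + + M) * esym k M (x + h)
      ≡⟨ cong₂ (λ u v → u + (x + h + + M) * v) (esym-taylor (suc k) M x h) (esym-taylor k M x h) ⟩
    antidiag f (suc k) + (x + h + + M) * antidiag f k
      ≡⟨ cong (λ u → antidiag f (suc k) + u * antidiag f k) (swap x h (+ M)) ⟩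
    antidiag f (suc k) + (x + + M + h) * antidiag f k
      ≡⟨ antidiag-step (x + + M) h f _ step k ⟨
    antidiag (taylorTerm (suc M) x h) (suc k) ∎
    where
    open ≡-Reasoning
    f = taylorTerm M x h
    swap : ∀ x h m → x + h + m ≡ x + m + h
    swap = solve-∀
    step : ∀ j i → taylorTerm (suc M) x h j i ≡ f j i + ((x + + M) * shiftˡ f j i + h * shiftʳ f j i)
    step zero    zero    = lemma (x + + M) h
      where
      lemma : ∀ c h → 1ℤ ≡ 1ℤ + (c * 0ℤ + h * 0ℤ)
      lemma = solve-∀
    step zero    (suc i) = trans (cong (λ u → 1ℤ * (h ^ suc i * u)) (pascal M i))
      (lemma (x + + M) h (h ^ i) (+ (M C i)) (+ (M C suc i)))
      where
      lemma : ∀ c h p a b → 1ℤ * ((h * p) * (a + b)) ≡ 1ℤ * ((h * p) * b) + (c * 0ℤ + h * (1ℤ * (p * a)))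
      lemma = solve-∀
    step (suc j) zero    = lemma (esym (suc j) M x) (x + + M) (esym j M x) h
      where
      lemma : ∀ a c b h → (a + c * b) * (1ℤ * 1ℤ) ≡ a * (1ℤ * 1ℤ) + (c * (b * (1ℤ * 1ℤ)) + h * 0ℤ)
      lemma = solve-∀
    step (suc j) (suc i) = begin
      (a + (x + + M) * b) * (h ^ suc i * B)
        ≡⟨ lemma₁ a (x + + M) b (h ^ suc i) B ⟩
      h ^ suc i * (a * B) + (x + + M) * (b * (h ^ suc i * B))
        ≡⟨ cong (λ u → h ^ suc i * u + (x + + M) * (b * (h ^ suc i * B))) top ⟩
      h ^ suc i * (a * (+ ((M ℕ.∸ suc j) C i) + + ((M ℕ.∸ suc j) C suc i))) + (x + + M) * (b * (h ^ suc i * B))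
        ≡⟨ lemma₂ a (x + + M) b h (h ^ i) B (+ ((M ℕ.∸ suc j) C i)) (+ ((M ℕ.∸ suc j) C suc i)) ⟩
      f (suc j) (suc i) + ((x + + M) * f j (suc i) + h * f (suc j) i) ∎
      where
      a = esym (suc j) M x
      b = esym j M x
      B = + ((M ℕ.∸ j) C suc i)
      lemma₁ : ∀ a c b p B → (a + c * b) * (p * B) ≡ p * (a * B) + c * (b * (p * B))
      lemma₁ = solve-∀
      lemma₂ : ∀ a c b h p B u v → (h * p) * (a * (u + v)) + c * (b * ((h * p) * B))
        ≡ a * ((h * p) * v) + (c * (b * ((h * p) * B)) + h * (a * (p * u)))
      lemma₂ = solve-∀
      -- Pascal's rule needs `M ∸ j` to be a successor. For j ≥ M truncation spoils this, but then
      -- `a` is 0 because its degree j + 1 exceeds M.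
      top : a * B ≡ a * (+ ((M ℕ.∸ suc j) C i) + + ((M ℕ.∸ suc j) C suc i))
      top with j ℕ.<? M
      ... | yes j<M = cong (a *_) (trans (cong (λ u → + (u C suc i)) M∸j) (pascal (M ℕ.∸ suc j) i))
        where
        M∸j : M ℕ.∸ j ≡ suc (M ℕ.∸ suc j)
        M∸j = ℕₚ.+-∸-assoc 1 j<M
      ... | no  j≮M rewrite esym-> (suc j) M x (s≤s (ℕₚ.≮⇒≥ j≮M)) = refl

  -- Divisibility of powers, of convolution sums and of shifted `esym`.

  pos-^ : ∀ m n → + (m ℕ.^ n) ≡ (+ m) ^ n
  pos-^ m zero    = refl
  pos-^ m (suc n) = trans (ℤₚ.pos-* m (m ℕ.^ n)) (cong (+ m *_) (pos-^ m n))

  ^-mono-∣ : ∀ x {m n} → m ℕ.≤ n → x ^ m ∣ x ^ n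
  ^-mono-∣ x {m} {n} m≤n = divides (x ^ (n ℕ.∸ m))
    (trans (cong (x ^_) (sym (ℕₚ.m∸n+n≡m m≤n))) (ℤₚ.^-distribˡ-+-* x (n ℕ.∸ m) m))

  *-mono-∣ : ∀ {a b c d} → a ∣ b → c ∣ d → a * c ∣ b * d
  *-mono-∣ {a} {b} {c} {d} a∣b c∣d = ∣-trans (*-monoˡ-∣ c a∣b) (*-monoʳ-∣ b c∣d)

  antidiag-∣ : ∀ {D} f k → (∀ j i → j ℕ.+ i ≡ k → D ∣ f j i) → D ∣ antidiag f k
  antidiag-∣ f zero    D∣f = D∣f 0 0 refl
  antidiag-∣ f (suc k) D∣f = ∣m∣n⇒∣m+n (D∣f 0 (suc k) refl)
    (antidiag-∣ (λ j → f (suc j)) k (λ j i e → D∣f (suc j) i (cong suc e)))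

  esym-∣-shift : ∀ k M x h → h ∣ esym k M (x + h) - esym k M x
  esym-∣-shift zero    M       x h = divides 0ℤ refl
  esym-∣-shift (suc k) zero    x h = divides 0ℤ refl
  esym-∣-shift (suc k) (suc M) x h = subst (h ∣_) (lemma (esym (suc k) M (x + h)) (esym (suc k) M x) x h (+ M) (esym k M (x + h)) (esym k M x))
    (∣m∣n⇒∣m+n (∣m∣n⇒∣m+n (esym-∣-shift (suc k) M x h) (∣n⇒∣m*n (x + h + + M) (esym-∣-shift k M x h)))
      (∣m⇒∣m*n (esym k M x) ∣-refl))
    where
    lemma : ∀ a′ a x h m b′ b → (a′ - a) + (x + h + m) * (b′ - b) + h * b
      ≡ (a′ + (x + h + m) * b′) - (a + (x + m) * b)
    lemma = solve-∀

  -- Here g is the derivative in the starting point. It is chosen before h, so that shifts by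
  -- different multiples of N share the same linear coefficient.
  esym-linear : ∀ k M x → ∃ λ g → ∀ h → h * h ∣ esym k M (x + h) - esym k M x - h * g
  esym-linear zero    M       x = 0ℤ , λ h → subst (h * h ∣_) (lemma h) (divides 0ℤ refl)
    where
    lemma : ∀ h → 0ℤ ≡ 1ℤ - 1ℤ - h * 0ℤ
    lemma = solve-∀
  esym-linear (suc k) zero    x = 0ℤ , λ h → subst (h * h ∣_) (lemma h) (divides 0ℤ refl)
    where
    lemma : ∀ h → 0ℤ ≡ 0ℤ - 0ℤ - h * 0ℤ
    lemma = solve-∀
  esym-linear (suc k) (suc M) x with esym-linear (suc k) M x | esym-linear k M x
  ... | g₁ , h²∣₁ | g₀ , h²∣₀ = g₁ + (x + + M) * g₀ + esym k M x , λ h →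
    subst (h * h ∣_) (lemma (esym (suc k) M (x + h)) (esym (suc k) M x) x h (+ M) (esym k M (x + h)) (esym k M x) g₁ g₀)
      (∣m∣n⇒∣m+n (∣m∣n⇒∣m+n (h²∣₁ h) (∣n⇒∣m*n (x + + M) (h²∣₀ h)))
        (*-monoʳ-∣ h (esym-∣-shift k M x h)))
    where
    lemma : ∀ a′ a x h m b′ b g₁ g₀ →
      (a′ - a - h * g₁) + (x + m) * (b′ - b - h * g₀) + h * (b′ - b)
      ≡ (a′ + (x + h + m) * b′) - (a + (x + m) * b) - h * (g₁ + (x + m) * g₀ + b)
    lemma = solve-∀

  -- The identity between consecutive degrees obtained by reflection.

  esym-suc-0 : ∀ k M → esym k (suc M) 0ℤ ≡ esym k M 1ℤ
  esym-suc-0 zero    M = refl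
  esym-suc-0 (suc k) M = trans (esym-front k M 0ℤ)
    (trans (cong (_+_ (esym (suc k) M 1ℤ)) (ℤₚ.*-zeroˡ (esym k M 1ℤ))) (ℤₚ.+-identityʳ _))

  antidiag-inner : ∀ f k → antidiag f (suc (suc k)) ≡
    f (suc (suc k)) 0 + f 0 (suc (suc k)) + antidiag (λ j i → f (suc j) (suc i)) k
  antidiag-inner f k = trans (cong (_+_ (f 0 (suc (suc k)))) (antidiag-peelʳ (λ j → f (suc j)) k))
    (lemma (f 0 (suc (suc k))) (f (suc (suc k)) 0) _)
    where
    lemma : ∀ a b c → a + (b + c) ≡ b + a + c
    lemma = solve-∀

  -1^[2j+1] : ∀ j → -1ℤ ^ (2 ℕ.* j ℕ.+ 1) ≡ -1ℤ
  -1^[2j+1] j = begin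
    -1ℤ ^ (2 ℕ.* j ℕ.+ 1)     ≡⟨ ℤₚ.^-distribˡ-+-* -1ℤ (2 ℕ.* j) 1 ⟩
    -1ℤ ^ (2 ℕ.* j) * -1ℤ     ≡⟨ cong (_* -1ℤ) (ℤₚ.^-*-assoc -1ℤ 2 j) ⟨
    1ℤ ^ j * -1ℤ              ≡⟨ cong (_* -1ℤ) (ℤₚ.^-zeroˡ j) ⟩
    -1ℤ                       ∎
    where open ≡-Reasoning

  -- Comparing the reflection i ↦ N - i of the factors of (1 + t)(1 + 2t)⋯(1 + (N-1)t) with the
  -- Taylor expansion of the shift by -N.
  esym-odd : ∀ j k M → suc (suc k) ≡ 2 ℕ.* j ℕ.+ 1 → suc k ℕ.≤ M →
    (+ suc M * (+ suc M - + suc (suc k))) * esym (suc k) (suc M) 0ℤ - + 2 * esym (suc (suc k)) (suc M) 0ℤ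
    ≡ antidiag (λ j i → taylorTerm M 1ℤ (- (+ suc M)) j (suc (suc i))) k
  esym-odd j k M odd k<M = begin
    (N * (N - K)) * esym (suc k) (suc M) 0ℤ - + 2 * esym (suc (suc k)) (suc M) 0ℤ
      ≡⟨ cong₂ (λ u v → (N * (N - K)) * u - + 2 * v) (esym-suc-0 (suc k) M) (esym-suc-0 (suc (suc k)) M) ⟩
    (N * (N - K)) * b - + 2 * a
      ≡⟨ lemma₁ N K a b ⟩
    -1ℤ * a - (a - N * (N - K) * b)
      ≡⟨ cong₂ (λ u v → u - (a - N * v * b)) reflected (sym diff) ⟩
    esym (suc (suc k)) M (1ℤ + h) - (a - N * c * b)
      ≡⟨ cong (_- (a - N * c * b)) expanded ⟩
    (a * (1ℤ * 1ℤ) + (b * (h * 1ℤ * c) + R)) - (a - N * c * b)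
      ≡⟨ lemma₂ a b N c R ⟩
    R ∎
    where
    open ≡-Reasoning
    N = + suc M
    K = + suc (suc k)
    h = - N
    a = esym (suc (suc k)) M 1ℤ
    b = esym (suc k) M 1ℤ
    c = + (M ℕ.∸ suc k)
    R = antidiag (λ j i → taylorTerm M 1ℤ h j (suc (suc i))) k
    lemma₁ : ∀ N K a b → (N * (N - K)) * b - + 2 * a ≡ -1ℤ * a - (a - N * (N - K) * b)
    lemma₁ = solve-∀
    lemma₂ : ∀ a b N c R → (a * (1ℤ * 1ℤ) + (b * ((- N) * 1ℤ * c) + R)) - (a - N * c * b) ≡ R
    lemma₂ = solve-∀
    diff : c ≡ N - K
    diff = trans (sym (ℤₚ.⊖-≥ k<M)) (trans (sym (ℤₚ.m-n≡m⊖n M (suc k))) (lemma (+ M) (+ suc k)))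
      where
      lemma : ∀ m k → m - k ≡ (1ℤ + m) - (1ℤ + k)
      lemma = solve-∀
    -- Reflection at x = 1 sends 1, ..., M to -M, ..., -1, which is the same block shifted by h =
    -- -N; the odd degree makes the sign -1.
    reflected : -1ℤ * a ≡ esym (suc (suc k)) M (1ℤ + h)
    reflected = trans (cong (_* a) (sym (trans (cong (-1ℤ ^_) odd) (-1^[2j+1] j))))
      (trans (sym (esym-reflect (suc (suc k)) M 1ℤ)) (cong (esym (suc (suc k)) M) (lemma (+ M))))
      where
      lemma : ∀ m → 1ℤ - 1ℤ - m ≡ 1ℤ + - (1ℤ + m)
      lemma = solve-∀
    -- The terms with i = 0 and i = 1 are peeled off, so that every term left in `R` carries at
    -- least h².
    expanded : esym (suc (suc k)) M (1ℤ + h) ≡ a * (1ℤ * 1ℤ) + (b * (h * 1ℤ * c) + R)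
    expanded = begin
      esym (suc (suc k)) M (1ℤ + h)
        ≡⟨ esym-taylor (suc (suc k)) M 1ℤ h ⟩
      antidiag t (suc (suc k))
        ≡⟨ antidiag-peelʳ t (suc k) ⟩
      a * (1ℤ * 1ℤ) + antidiag (λ j i → t j (suc i)) (suc k)
        ≡⟨ cong (_+_ (a * (1ℤ * 1ℤ))) (antidiag-peelʳ (λ j i → t j (suc i)) k) ⟩
      a * (1ℤ * 1ℤ) + (b * (h * 1ℤ * + ((M ℕ.∸ suc k) C 1)) + R)
        ≡⟨ cong (λ u → a * (1ℤ * 1ℤ) + (b * (h * 1ℤ * + u) + R)) (nC1≡n (M ℕ.∸ suc k)) ⟩
      a * (1ℤ * 1ℤ) + (b * (h * 1ℤ * c) + R) ∎
      where
      t = taylorTerm M 1ℤ h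

  -- Two numerical inequalities.

  -- For p ≥ 3 this forces p^s ≤ i + 2 to imply s ≤ i, which is `val-≤`.
  2+i<3^[1+i] : ∀ i → 2 ℕ.+ i ℕ.< 3 ℕ.^ suc i
  2+i<3^[1+i] zero    = ℕₚ.≤-refl
  2+i<3^[1+i] (suc i) = begin-strict
    suc (2 ℕ.+ i)                       ≡⟨ ℕₚ.+-comm 1 (2 ℕ.+ i) ⟩
    2 ℕ.+ i ℕ.+ 1                       <⟨ ℕₚ.+-mono-<-≤ (2+i<3^[1+i] i) (ℕₚ.m^n>0 3 (suc i)) ⟩
    3 ℕ.^ suc i ℕ.+ 3 ℕ.^ suc i         ≤⟨ ℕₚ.+-monoʳ-≤ (3 ℕ.^ suc i) (ℕₚ.m≤m+n (3 ℕ.^ suc i) _) ⟩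
    3 ℕ.^ suc (suc i)                   ∎
    where open ℕₚ.≤-Reasoning

  -- The difference of the two sides is (x - y)². It turns two denominator bounds 2x and 2y into one
  -- bound by the square of the total degree.
  4xy≤[x+y]² : ∀ x y → (2 ℕ.* x) ℕ.* (2 ℕ.* y) ℕ.≤ (x ℕ.+ y) ℕ.* (x ℕ.+ y)
  4xy≤[x+y]² x y with ℕₚ.≤-total x y
  ... | inj₁ x≤y = subst (λ y → (2 ℕ.* x) ℕ.* (2 ℕ.* y) ℕ.≤ (x ℕ.+ y) ℕ.* (x ℕ.+ y)) (ℕₚ.m+[n∸m]≡n x≤y)
    (subst ((2 ℕ.* x) ℕ.* (2 ℕ.* (x ℕ.+ (y ℕ.∸ x))) ℕ.≤_) (lemma x (y ℕ.∸ x)) (ℕₚ.m≤m+n _ _))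
    where
    lemma : ∀ x d → (2 ℕ.* x) ℕ.* (2 ℕ.* (x ℕ.+ d)) ℕ.+ d ℕ.* d ≡ (x ℕ.+ (x ℕ.+ d)) ℕ.* (x ℕ.+ (x ℕ.+ d))
    lemma = ℕRing.solve-∀
  ... | inj₂ y≤x = subst (λ x → (2 ℕ.* x) ℕ.* (2 ℕ.* y) ℕ.≤ (x ℕ.+ y) ℕ.* (x ℕ.+ y)) (ℕₚ.m+[n∸m]≡n y≤x)
    (subst ((2 ℕ.* (y ℕ.+ (x ℕ.∸ y))) ℕ.* (2 ℕ.* y) ℕ.≤_) (lemma y (x ℕ.∸ y)) (ℕₚ.m≤m+n _ _))
    where
    lemma : ∀ y d → (2 ℕ.* (y ℕ.+ d)) ℕ.* (2 ℕ.* y) ℕ.+ d ℕ.* d ≡ ((y ℕ.+ d) ℕ.+ y) ℕ.* ((y ℕ.+ d) ℕ.+ y)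
    lemma = ℕRing.solve-∀

  -- Symmetric polynomials of 0, ..., N - 1 as integer combinations of binomials.

  -- The lower index starts at 1, because divisibility of N says nothing about C(N, 0) = 1.
  -- Equalities are pointwise, so no function extensionality is needed.
  data BinomialSpan (R : ℕ) : (ℕ → ℤ) → Set where
    none : ∀ {f} → (∀ N → f N ≡ 0ℤ) → BinomialSpan R f
    term : ∀ {f g} c r → suc r ℕ.≤ R → BinomialSpan R g → (∀ N → f N ≡ c * + (N C suc r) + g N) → BinomialSpan R f

  partialSum : (ℕ → ℤ) → ℕ → ℤ
  partialSum g zero    = 0ℤ
  partialSum g (suc N) = partialSum g N + + N * g N

  0Csuc : ∀ r → + (0 C suc r) ≡ 0ℤ
  0Csuc r = cong +_ (k>n⇒nCk≡0 {0} {suc r} (s≤s z≤n))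

  -- Since i C(i, s) = s C(i, s) + (s + 1) C(i, s + 1), summation over i < N gives s C(N, s + 1) +
  -- (s + 1) C(N, s + 2). Hence the largest lower index grows by at most 2.
  span-partialSum : ∀ {R f} → BinomialSpan R f → ∀ h → h 0 ≡ 0ℤ → (∀ N → h (suc N) ≡ h N + + N * f N) →
    BinomialSpan (2 ℕ.+ R) h
  span-partialSum (none f≡0) h h0 hs = none vanish
    where
    vanish : ∀ N → h N ≡ 0ℤ
    vanish zero    = h0
    vanish (suc N) = trans (hs N) (trans (cong₂ (λ u v → u + + N * v) (vanish N) (f≡0 N))
      (trans (ℤₚ.+-identityˡ _) (ℤₚ.*-zeroʳ (+ N))))
  span-partialSum {R} {f} (term {g = g} c r r<R sp f≡) h h0 hs =
    term (c * + suc (suc r)) (suc (suc r)) (s≤s (s≤s r<R))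
      (term (c * + suc r) (suc r) (s≤s (ℕₚ.m≤n⇒m≤1+n r<R))
        (span-partialSum sp (partialSum g) refl (λ _ → refl)) (λ _ → refl)) h≡
    where
    lemma₀ : ∀ c a b → 0ℤ ≡ c * a * 0ℤ + (c * b * 0ℤ + 0ℤ)
    lemma₀ = solve-∀
    lemma₁ : ∀ c r n x y z s g → (c * (1ℤ + r) * z + (c * r * y + s)) + n * (c * x + g)
      ≡ (c * (1ℤ + r) * (y + z) + (c * r * (x + y) + (s + n * g))) + c * (((n - r) * x) - (1ℤ + r) * y)
    lemma₁ = solve-∀
    lemma₂ : ∀ a c x → a + c * (x - x) ≡ a
    lemma₂ = solve-∀
    h≡ : ∀ N → h N ≡ c * + suc (suc r) * + (N C suc (suc (suc r)))
      + (c * + suc r * + (N C suc (suc r)) + partialSum g N)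
    h≡ zero = trans h0 (sym (trans
      (cong₂ (λ u v → c * + suc (suc r) * u + (c * + suc r * v + 0ℤ)) (0Csuc (suc (suc r))) (0Csuc (suc r)))
      (sym (lemma₀ c (+ suc (suc r)) (+ suc r)))))
    h≡ (suc N) = begin
      h (suc N)
        ≡⟨ hs N ⟩
      h N + + N * f N
        ≡⟨ cong₂ (λ u v → u + + N * v) (h≡ N) (f≡ N) ⟩
      (c * + suc (suc r) * Z + (c * + suc r * Y + partialSum g N)) + + N * (c * X + g N)
        ≡⟨ lemma₁ c (+ suc r) (+ N) X Y Z (partialSum g N) (g N) ⟩
      A + c * ((+ N - + suc r) * X - + suc (suc r) * Y)
        ≡⟨ cong (λ u → A + c * ((+ N - + suc r) * X - u)) ([k+1]*nC[k+1]≡[n-k]*nCk N (suc r)) ⟩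
      A + c * ((+ N - + suc r) * X - (+ N - + suc r) * X)
        ≡⟨ lemma₂ A c ((+ N - + suc r) * X) ⟩
      A
        ≡⟨ cong₂ (λ u v → c * + suc (suc r) * u + (c * + suc r * v + (partialSum g N + + N * g N)))
             (pascal N (suc (suc r))) (pascal N (suc r)) ⟨
      c * + suc (suc r) * + (suc N C suc (suc (suc r)))
        + (c * + suc r * + (suc N C suc (suc r)) + partialSum g (suc N)) ∎
      where
      open ≡-Reasoning
      X = + (N C suc r)
      Y = + (N C suc (suc r))
      Z = + (N C suc (suc (suc r)))
      A = c * + suc (suc r) * (Y + Z) + (c * + suc r * (X + Y) + (partialSum g N + + N * g N))

  -- The start is e_1 = C(N, 2). At x = 0 the recursion of `esym` is a sum weighted by the new
  -- variable, so each further degree costs 2 in the lower index.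
  esym-span : ∀ k → BinomialSpan (2 ℕ.* suc k) (λ N → esym (suc k) N 0ℤ)
  esym-span zero = term 1ℤ 1 (s≤s (s≤s z≤n)) (none {f = λ _ → 0ℤ} (λ _ → refl)) NC2
    where
    lemma : ∀ c n → (1ℤ * c + 0ℤ) + (0ℤ + n) * 1ℤ ≡ 1ℤ * (n + c) + 0ℤ
    lemma = solve-∀
    NC2 : ∀ N → esym 1 N 0ℤ ≡ 1ℤ * + (N C 2) + 0ℤ
    NC2 zero    = refl
    NC2 (suc N) = trans (cong (λ u → u + (0ℤ + + N) * 1ℤ) (NC2 N)) (trans (lemma (+ (N C 2)) (+ N))
      (cong (λ u → 1ℤ * u + 0ℤ) (trans (cong (λ u → + u + + (N C 2)) (sym (nC1≡n N))) (sym (pascal N 1)))))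
  esym-span (suc k) = subst (λ R → BinomialSpan R (λ N → esym (suc (suc k)) N 0ℤ)) (sym (ℕₚ.*-suc 2 (suc k)))
    (span-partialSum (esym-span k) _ refl
      (λ N → cong (λ u → esym (suc (suc k)) N 0ℤ + u * esym (suc k) N 0ℤ) (ℤₚ.+-identityˡ (+ N))))

  -- Calculus of p-adic valuations on the integers.

  module _ {p : ℕ} (p-prime : Prime p) where

    private
      P : ℤ
      P = + p

      instance
        p≢0 : ℕ.NonZero p
        p≢0 = prime⇒nonZero p-prime

      1<p : 1 ℕ.< p
      1<p = ℕ.nonTrivial⇒n>1 p {{prime⇒nonTrivial p-prime}}

      P^≢0 : ∀ n → ℤ.NonZero (P ^ n)
      P^≢0 n = subst ℤ.NonZero (pos-^ p n) (ℕₚ.m^n≢0 p n)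

    prime-∣* : ∀ {x y} → P ∣ x * y → P ∣ x ⊎ P ∣ y
    prime-∣* {x} {y} P∣xy with euclidsLemma ℤ.∣ x ∣ ℤ.∣ y ∣ p-prime (subst (p ℕ∣.∣_) (ℤₚ.abs-* x y) (∣⇒∣ᵤ P∣xy))
    ... | inj₁ p∣x = inj₁ (∣ᵤ⇒∣ p∣x)
    ... | inj₂ p∣y = inj₂ (∣ᵤ⇒∣ p∣y)

    ^-cancel-∣ : ∀ s {m x} → P ^ (s ℕ.+ m) ∣ P ^ s * x → P ^ m ∣ x
    ^-cancel-∣ s {m} {x} d = *-cancelˡ-∣ (P ^ s) {{P^≢0 s}} (subst (_∣ P ^ s * x) (ℤₚ.^-distribˡ-+-* P s m) d)

    -- Euclid's lemma extracts one factor p from x at a time.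
    coprime-∣ : ∀ n {u x} → ¬ P ∣ u → P ^ n ∣ u * x → P ^ n ∣ x
    coprime-∣ zero {x = x} P∤u d = divides x (sym (ℤₚ.*-identityʳ x))
    coprime-∣ (suc n) {u} {x} P∤u d with prime-∣* {u} {x} (∣-trans (divides (P ^ n) (ℤₚ.*-comm P (P ^ n))) d)
    ... | inj₁ P∣u = ⊥-elim (P∤u P∣u)
    ... | inj₂ (divides y refl) = subst (_∣ y * P) (ℤₚ.*-comm (P ^ n) P) (*-monoˡ-∣ P
            (coprime-∣ n P∤u (*-cancelʳ-∣ P (subst₂ _∣_ (ℤₚ.*-comm P (P ^ n)) (sym (ℤₚ.*-assoc u y P)) d))))

    -- Keeping the cofactor as a witness lets products, signs and perturbations act on it directly,
    -- where `IsVal` offers only two divisibility statements about naturals.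
    record HasVal (v : ℕ) (x : ℤ) : Set where
      constructor hasVal
      field
        unit        : ℤ
        equality    : x ≡ P ^ v * unit
        P∤unit      : ¬ P ∣ unit

    HasVal-* : ∀ {v w x y} → HasVal v x → HasVal w y → HasVal (v ℕ.+ w) (x * y)
    HasVal-* {v} {w} (hasVal a refl P∤a) (hasVal b refl P∤b) = hasVal (a * b)
      (trans (lemma (P ^ v) a (P ^ w) b) (cong (_* (a * b)) (sym (ℤₚ.^-distribˡ-+-* P v w)))) P∤ab
      where
      lemma : ∀ x a y b → (x * a) * (y * b) ≡ (x * y) * (a * b)
      lemma = solve-∀
      P∤ab : ¬ P ∣ a * b
      P∤ab d with prime-∣* {a} {b} d
      ... | inj₁ P∣a = P∤a P∣a
      ... | inj₂ P∣b = P∤b P∣b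

    HasVal-+ : ∀ {v x y} → HasVal v x → P ^ suc v ∣ y → HasVal v (x + y)
    HasVal-+ {v} (hasVal a refl P∤a) (divides q refl) = hasVal (a + q * P) (lemma (P ^ v) a P q)
      (λ d → P∤a (∣m+n∣n⇒∣m d (∣n⇒∣m*n q ∣-refl)))
      where
      lemma : ∀ x a p q → x * a + q * (p * x) ≡ x * (a + q * p)
      lemma = solve-∀

    HasVal-neg : ∀ {v x} → HasVal v x → HasVal v (- x)
    HasVal-neg {v} (hasVal a refl P∤a) = hasVal (- a) (ℤₚ.neg-distribʳ-* (P ^ v) a)
      (λ d → P∤a (subst (P ∣_) (ℤₚ.neg-involutive a) (∣m⇒∣-m d)))

    HasVal-P : HasVal 1 P
    HasVal-P = hasVal 1ℤ (lemma P) (λ d → ℕₚ.<⇒≱ 1<p (ℕ∣.∣⇒≤ (∣⇒∣ᵤ d)))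
      where
      lemma : ∀ x → x ≡ x * 1ℤ * 1ℤ
      lemma = solve-∀

    HasVal-cancel : ∀ {v c x} → ¬ P ∣ c → HasVal v (c * x) → HasVal v x
    HasVal-cancel {v} {c} {x} P∤c (hasVal u eq P∤u) with coprime-∣ v P∤c (divides u (trans eq (ℤₚ.*-comm (P ^ v) u)))
    ... | divides y refl = hasVal y (ℤₚ.*-comm y (P ^ v))
      (λ P∣y → P∤u (subst (P ∣_) (ℤₚ.*-cancelˡ-≡ (P ^ v) (c * y) u {{P^≢0 v}} (trans (lemma (P ^ v) c y) eq)) (∣n⇒∣m*n c P∣y)))
      where
      lemma : ∀ q c y → q * (c * y) ≡ c * (y * q)
      lemma = solve-∀

    HasVal-∣ : ∀ {v x} → HasVal v x → P ^ v ∣ x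
    HasVal-∣ {v} (hasVal u refl _) = ∣m⇒∣m*n u ∣-refl

    HasVal-∤ : ∀ {v x} → HasVal v x → ¬ P ^ suc v ∣ x
    HasVal-∤ {v} (hasVal u refl P∤u) d =
      P∤u (subst (_∣ u) (ℤₚ.*-identityʳ P) (^-cancel-∣ v {1} (subst (λ i → P ^ i ∣ P ^ v * u) (ℕₚ.+-comm 1 v) d)))

    HasVal⇒IsVal : ∀ {v m} → HasVal v (+ m) → IsVal p m v
    HasVal⇒IsVal {v} {m} h =
      ∣⇒∣ᵤ (subst (_∣ + m) (sym (pos-^ p v)) (HasVal-∣ h)) ,
      λ d → HasVal-∤ h (subst (_∣ + m) (pos-^ p (suc v)) (∣ᵤ⇒∣ d))

    IsVal⇒HasVal : ∀ {v m} → IsVal p m v → HasVal v (+ m)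
    IsVal⇒HasVal {v} {m} (p^v∣m , p^1+v∤m) with subst (_∣ + m) (pos-^ p v) (∣ᵤ⇒∣ p^v∣m)
    ... | divides u eq = hasVal u (trans eq (ℤₚ.*-comm u (P ^ v)))
      (λ P∣u → p^1+v∤m (∣⇒∣ᵤ (subst₂ _∣_ (sym (pos-^ p (suc v))) (sym eq) (*-monoˡ-∣ (P ^ v) P∣u))))

    -- Divisibility of binomials and of `esym` when p^n divides N.

    -- Strong induction dividing out p. The size bound on p^s is recorded because it limits every
    -- later loss of p-powers.
    suc-val : ∀ r → ∃ λ s → p ℕ.^ s ℕ.≤ suc r × HasVal s (+ suc r)
    suc-val = <-rec _ go
      where
      go : ∀ r → (∀ {r′} → r′ ℕ.< r → ∃ λ s → p ℕ.^ s ℕ.≤ suc r′ × HasVal s (+ suc r′)) →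
        ∃ λ s → p ℕ.^ s ℕ.≤ suc r × HasVal s (+ suc r)
      go r rec with p ℕ∣.∣? suc r
      ... | no  p∤r = 0 , s≤s z≤n , hasVal (+ suc r) (sym (ℤₚ.*-identityˡ (+ suc r))) (λ d → p∤r (∣⇒∣ᵤ d))
      ... | yes (ℕ∣.divides (suc q) eq) with rec {q} (ℕ.s≤s⁻¹ (subst (suc q ℕ.<_) (sym eq) (ℕₚ.m<m*n (suc q) p 1<p)))
      ... | s , p^s≤q , val = suc s ,
        subst (p ℕ.^ suc s ℕ.≤_) (trans (ℕₚ.*-comm p (suc q)) (sym eq)) (ℕₚ.*-monoʳ-≤ p p^s≤q) ,
        subst (HasVal (suc s)) (sym (trans (cong +_ (trans eq (ℕₚ.*-comm (suc q) p))) (ℤₚ.pos-* p (suc q))))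
          (HasVal-* {1} HasVal-P val)

    -- By absorption (r + 1) C(N, r + 1) is a multiple of N; the part of r + 1 prime to p is
    -- cancelled and only its p-part p^c remains.
    binomial-∣ : ∀ n N r → P ^ n ∣ + N → ∃ λ c → p ℕ.^ c ℕ.≤ suc r × P ^ n ∣ P ^ c * + (N C suc r)
    binomial-∣ n zero    r _ = 0 , s≤s z≤n , subst (λ u → P ^ n ∣ 1ℤ * u) (sym (0Csuc r)) (divides 0ℤ refl)
    binomial-∣ n (suc N) r d with suc-val r
    ... | s , p^s≤r , hasVal u eq P∤u = s , p^s≤r , coprime-∣ n P∤u
      (subst (P ^ n ∣_) (trans (sym (absorption N r)) (trans (cong (_* B) eq) (lemma (P ^ s) u B)))
        (∣m⇒∣m*n (+ (N C r)) d))
      where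
      B = + (suc N C suc r)
      lemma : ∀ q u c → (q * u) * c ≡ u * (q * c)
      lemma = solve-∀

    -- One power of p serves all terms: the largest of their exponents, not the sum, so the bound
    -- `R` survives.
    span-∣ : ∀ {n N R f} → 1 ℕ.≤ R → P ^ n ∣ + N → BinomialSpan R f → ∃ λ c → p ℕ.^ c ℕ.≤ R × P ^ n ∣ P ^ c * f N
    span-∣ {n} {N} 1≤R d (none f≡0) = 0 , 1≤R , subst (λ u → P ^ n ∣ 1ℤ * u) (sym (f≡0 N)) (divides 0ℤ refl)
    span-∣ {n} {N} {R} {f} 1≤R d (term {g = g} b r r<R sp f≡) with span-∣ {n} 1≤R d sp | binomial-∣ n N r d
    ... | c₁ , b₁ , d₁ | c₂ , b₂ , d₂ = c₁ ℕ.⊔ c₂ , bound , subst (P ^ n ∣_) eq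
        (∣m∣n⇒∣m+n (∣n⇒∣m*n b (∣-trans d₂ (*-monoˡ-∣ B (^-mono-∣ P (ℕₚ.m≤n⊔m c₁ c₂)))))
                   (∣-trans d₁ (*-monoˡ-∣ (g N) (^-mono-∣ P (ℕₚ.m≤m⊔n c₁ c₂)))))
      where
      B = + (N C suc r)
      bound : p ℕ.^ (c₁ ℕ.⊔ c₂) ℕ.≤ R
      bound with ℕₚ.⊔-sel c₁ c₂
      ... | inj₁ e = subst (λ c → p ℕ.^ c ℕ.≤ R) (sym e) b₁
      ... | inj₂ e = subst (λ c → p ℕ.^ c ℕ.≤ R) (sym e) (ℕₚ.≤-trans b₂ r<R)
      lemma : ∀ b q c g → b * (q * c) + q * g ≡ q * (b * c + g)
      lemma = solve-∀
      eq : b * (P ^ (c₁ ℕ.⊔ c₂) * B) + P ^ (c₁ ℕ.⊔ c₂) * g N ≡ P ^ (c₁ ℕ.⊔ c₂) * f N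
      eq = trans (lemma b (P ^ (c₁ ℕ.⊔ c₂)) B (g N)) (cong (P ^ (c₁ ℕ.⊔ c₂) *_) (sym (f≡ N)))

    esym-∣ : ∀ n N k → P ^ n ∣ + N → ∃ λ c → p ℕ.^ c ℕ.≤ 2 ℕ.* suc k × P ^ n ∣ P ^ c * esym (suc k) N 0ℤ
    esym-∣ n N k d = span-∣ {n} (s≤s z≤n) d (esym-span k)

    ^-cancel-< : ∀ {c n} → p ℕ.^ c ℕ.< p ℕ.^ n → c ℕ.< n
    ^-cancel-< {c} {n} lt = ℕₚ.≰⇒> (λ n≤c → ℕₚ.<⇒≱ lt (ℕₚ.^-monoʳ-≤ p n≤c))

    -- Multiplying gives p^(2n) ∣ p^(c+d) x y, and 2n - (c + d) ≥ n + 1.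
    *-∣-excess : ∀ {n} c d {x y} → c ℕ.+ d ℕ.< n → P ^ n ∣ P ^ c * x → P ^ n ∣ P ^ d * y → P ^ suc n ∣ x * y
    *-∣-excess {n} c d {x} {y} c+d<n ∣x ∣y = ^-cancel-∣ (c ℕ.+ d)
      (∣-trans (^-mono-∣ P (subst (ℕ._≤ n ℕ.+ n) (sym (ℕₚ.+-suc (c ℕ.+ d) n)) (ℕₚ.+-monoˡ-≤ n c+d<n)))
        (subst₂ _∣_ (sym (ℤₚ.^-distribˡ-+-* P n n))
          (trans (lemma (P ^ c) x (P ^ d) y) (cong (_* (x * y)) (sym (ℤₚ.^-distribˡ-+-* P c d))))
          (*-mono-∣ ∣x ∣y)))
      where
      lemma : ∀ a x b y → (a * x) * (b * y) ≡ (a * b) * (x * y)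
      lemma = solve-∀

    -- Modulo p^n a block starting at x looks like the one starting at 0. The form `0ℤ + x` is the
    -- one that `esym-split` produces.
    esym-shift-∣ : ∀ n N k x → P ^ n ∣ + N → P ^ n ∣ x →
      ∃ λ c → p ℕ.^ c ℕ.≤ 2 ℕ.* suc k × P ^ n ∣ P ^ c * esym (suc k) N (0ℤ + x)
    esym-shift-∣ n N k x d dx with esym-∣ n N k d
    ... | c , b , dc = c , b , subst (P ^ n ∣_) (lemma (P ^ c) _ (esym (suc k) N 0ℤ))
      (∣m∣n⇒∣m+n (∣n⇒∣m*n (P ^ c) (∣-trans dx (esym-∣-shift (suc k) N 0ℤ x))) dc)
      where
      lemma : ∀ q a b → q * (a - b) + q * b ≡ q * a
      lemma = solve-∀

    -- The two losses satisfy p^(c+d) ≤ 2(j+1) · 2(i+1) ≤ (j + i + 2)² < p^n, so c + d < n.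
    esym-product-∣ : ∀ n N N′ x j i → P ^ n ∣ + N → P ^ n ∣ + N′ → P ^ n ∣ x →
      (suc j ℕ.+ suc i) ℕ.* (suc j ℕ.+ suc i) ℕ.< p ℕ.^ n →
      P ^ suc n ∣ esym (suc j) N 0ℤ * esym (suc i) N′ (0ℤ + x)
    esym-product-∣ n N N′ x j i dN dN′ dx lt with esym-∣ n N j dN | esym-shift-∣ n N′ i x dN′ dx
    ... | c , bc , dc | d , bd , dd = *-∣-excess {n} c d (^-cancel-< (ℕₚ.≤-<-trans
      (subst (ℕ._≤ (suc j ℕ.+ suc i) ℕ.* (suc j ℕ.+ suc i)) (sym (ℕₚ.^-distribˡ-+-* p c d))
        (ℕₚ.≤-trans (ℕₚ.*-mono-≤ bc bd) (4xy≤[x+y]² (suc j) (suc i)))) lt)) dc dd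

    pos*-∣ : ∀ n q N → P ^ n ∣ + N → P ^ n ∣ + (q ℕ.* N)
    pos*-∣ n q N d = subst (P ^ n ∣_) (sym (ℤₚ.pos-* q N)) (∣n⇒∣m*n (+ q) d)

    -- Passing from N to pN.

    module _ (3≤p : 3 ℕ.≤ p) where

      P∤2 : ¬ P ∣ + 2
      P∤2 d = ℕₚ.<⇒≱ 3≤p (ℕ∣.∣⇒≤ (∣⇒∣ᵤ d))

      -- The q-th block of N factors contributes e_m(N) + qN·g modulo N², the mixed products
      -- between blocks vanish modulo p^{n+1}, and Σ_{q<p} q is divisible by p.
      esym-block-∣ : ∀ n N k → 1 ℕ.≤ n → P ^ n ∣ + N →
        (2 ℕ.+ k) ℕ.* (2 ℕ.+ k) ℕ.< p ℕ.^ n →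
        P ^ suc n ∣ esym (2 ℕ.+ k) (p ℕ.* N) 0ℤ - P * esym (2 ℕ.+ k) N 0ℤ
      -- The congruence is proved doubled, because the blocks accumulate Σ_{q<p} q = p(p-1)/2; the 2
      -- is cancelled as p does not divide it. The term p(p-1)NG left by `blocks p` is a multiple of
      -- pN and drops out.
      esym-block-∣ n N k 1≤n dN lt = coprime-∣ (suc n) P∤2
        (subst (P ^ suc n ∣_) (lemma₁ (u p) P (+ N) G e)
          (∣m∣n⇒∣m+n (blocks p) (∣n⇒∣m*n ((P - 1ℤ) * G) (*-mono-∣ (∣-refl {P}) dN))))
        where
        m = 2 ℕ.+ k
        e = esym m N 0ℤ
        G = proj₁ (esym-linear m N 0ℤ)
        u : ℕ → ℤ
        u q = esym m (q ℕ.* N) 0ℤ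
        lemma₁ : ∀ u p n g e → (+ 2 * u - (+ 2 * p * e + p * (p - 1ℤ) * n * g)) + (p - 1ℤ) * g * (p * n)
          ≡ + 2 * (u - p * e)
        lemma₁ = solve-∀
        lemma₂ : ∀ n g e → 0ℤ ≡ + 2 * 0ℤ - (+ 2 * 0ℤ * e + 0ℤ * (0ℤ - 1ℤ) * n * g)
        lemma₂ = solve-∀
        lemma₃ : ∀ q n g e u v s → (+ 2 * u - (+ 2 * q * e + q * (q - 1ℤ) * n * g)) + + 2 * (v - e - (q * n) * g) + + 2 * s
          ≡ + 2 * (u * 1ℤ + 1ℤ * v + s) - (+ 2 * (1ℤ + q) * e + (1ℤ + q) * ((1ℤ + q) - 1ℤ) * n * g)
        lemma₃ = solve-∀
        n<2n : suc n ℕ.≤ n ℕ.+ n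
        n<2n = ℕₚ.+-monoˡ-≤ n 1≤n
        -- Invariant modulo p^(n+1): 2 e_m(qN) ≡ 2q e_m(N) + q(q-1) N G.
        blocks : ∀ q → P ^ suc n ∣ + 2 * u q - (+ 2 * + q * e + + q * (+ q - 1ℤ) * + N * G)
        blocks zero    = subst (P ^ suc n ∣_) (lemma₂ (+ N) G e) (divides 0ℤ refl)
        blocks (suc q) = subst (P ^ suc n ∣_)
          (trans (lemma₃ (+ q) (+ N) G e (u q) v inner)
            (cong (λ w → + 2 * w - (+ 2 * + suc q * e + + suc q * (+ suc q - 1ℤ) * + N * G)) (sym split)))
          (∣m∣n⇒∣m+n (∣m∣n⇒∣m+n (blocks q) (∣n⇒∣m*n (+ 2) second-order)) (∣n⇒∣m*n (+ 2) inner-∣))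
          where
          x = + (q ℕ.* N)
          v = esym m N (0ℤ + x)
          f : ℕ → ℕ → ℤ
          f j i = esym j (q ℕ.* N) 0ℤ * esym i N (0ℤ + x)
          inner = antidiag (λ j i → f (suc j) (suc i)) k
          -- The two ends of the convolution are the old blocks alone and the new block alone;
          -- `inner` collects the mixed products.
          split : u (suc q) ≡ u q * 1ℤ + 1ℤ * v + inner
          split = trans (cong (λ M → esym m M 0ℤ) (ℕₚ.+-comm N (q ℕ.* N)))
            (trans (esym-split m (q ℕ.* N) N 0ℤ) (antidiag-inner f k))
          second-order : P ^ suc n ∣ v - e - (+ q * + N) * G
          second-order = subst (λ y → P ^ suc n ∣ v - e - y * G) (ℤₚ.pos-* q N)
            (∣-trans (∣-trans (^-mono-∣ P n<2n)
              (subst (_∣ x * x) (sym (ℤₚ.^-distribˡ-+-* P n n)) (*-mono-∣ (pos*-∣ n q N dN) (pos*-∣ n q N dN))))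
              (proj₂ (esym-linear m N 0ℤ) x))
          inner-∣ : P ^ suc n ∣ inner
          inner-∣ = antidiag-∣ _ k (λ j i j+i≡k →
            esym-product-∣ n (q ℕ.* N) N x j i (pos*-∣ n q N dN) dN (pos*-∣ n q N dN)
              (subst (λ d → d ℕ.* d ℕ.< p ℕ.^ n)
                (sym (trans (cong suc (ℕₚ.+-suc j i)) (cong (2 ℕ.+_) j+i≡k))) lt))

      -- The error in e_m(pN) ≡ p e_m(N) is a multiple of p^(n+1), and w < n makes that strictly
      -- finer than the valuation w + 1 of p e_m(N).
      esym-val-step : ∀ {n w} N k → P ^ n ∣ + N → (2 ℕ.+ k) ℕ.* (2 ℕ.+ k) ℕ.< p ℕ.^ n → w ℕ.< n →
        HasVal w (esym (2 ℕ.+ k) N 0ℤ) → HasVal (suc w) (esym (2 ℕ.+ k) (p ℕ.* N) 0ℤ)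
      esym-val-step {n} {w} N k dN lt w<n val = subst (HasVal (suc w)) (lemma (P * e) e′)
        (HasVal-+ (HasVal-* HasVal-P val)
          (∣-trans (^-mono-∣ P (s≤s w<n)) (esym-block-∣ n N k (ℕₚ.≤-trans (s≤s z≤n) w<n) dN lt)))
        where
        e = esym (2 ℕ.+ k) N 0ℤ
        e′ = esym (2 ℕ.+ k) (p ℕ.* N) 0ℤ
        lemma : ∀ a b → a + (b - a) ≡ b
        lemma = solve-∀

      -- The valuation in odd degree from the valuation one degree below.

      val-≤ : ∀ s i → p ℕ.^ s ℕ.≤ 2 ℕ.+ i → s ℕ.≤ i
      val-≤ s i p^s≤ = ℕₚ.≮⇒≥ (λ i<s → ℕₚ.<⇒≱ (2+i<3^[1+i] i)
        (ℕₚ.≤-trans (ℕₚ.^-monoˡ-≤ (suc i) 3≤p) (ℕₚ.≤-trans (ℕₚ.^-monoʳ-≤ p i<s) p^s≤)))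

      -- The factor h^(i+2) supplies p^(2n) and a further p^(ni). The binomial supplies p^κ, because
      -- (i + 2) C(M - j, i + 2) is a multiple of M - j - i - 1 = M - (k + 1), up to the p-part p^s
      -- of i + 2. That loss is repaid, since s ≤ i ≤ ni.
      taylorTerm-∣ : ∀ {n κ} M k j i h → 1 ℕ.≤ n → suc k ℕ.≤ M → j ℕ.+ i ≡ k → P ^ n ∣ h →
        P ^ κ ∣ + M - + suc k → P ^ (n ℕ.+ n ℕ.+ κ) ∣ taylorTerm M 1ℤ h j (suc (suc i))
      taylorTerm-∣ {n} {κ} M k j i h 1≤n k<M j+i≡k dh dM with suc-val (suc i)
      ... | s , p^s≤ , hasVal t eq P∤t = ∣n⇒∣m*n (esym j M 1ℤ)
        (subst (_∣ h ^ (2 ℕ.+ i) * B) (sym (ℤₚ.^-distribˡ-+-* P (n ℕ.+ n) κ)) (go h^-∣))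
        where
        B = + ((M ℕ.∸ j) C suc (suc i))
        h^-∣ : P ^ (n ℕ.+ n ℕ.+ s) ∣ h ^ (2 ℕ.+ i)
        h^-∣ = ∣-trans (^-mono-∣ P exponent) (subst (_∣ h ^ (2 ℕ.+ i)) (ℤₚ.^-*-assoc P n (2 ℕ.+ i)) (^-∣ (2 ℕ.+ i)))
          where
          ^-∣ : ∀ r → (P ^ n) ^ r ∣ h ^ r
          ^-∣ zero    = ∣-refl
          ^-∣ (suc r) = *-mono-∣ dh (^-∣ r)
          exponent : n ℕ.+ n ℕ.+ s ℕ.≤ n ℕ.* (2 ℕ.+ i)
          exponent = subst (n ℕ.+ n ℕ.+ s ℕ.≤_) (lemma n i)
            (ℕₚ.+-monoʳ-≤ (n ℕ.+ n) (ℕₚ.≤-trans (val-≤ s i p^s≤)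
              (subst (ℕ._≤ n ℕ.* i) (ℕₚ.*-identityˡ i) (ℕₚ.*-monoˡ-≤ i 1≤n))))
            where
            lemma : ∀ n i → n ℕ.+ n ℕ.+ n ℕ.* i ≡ n ℕ.* (2 ℕ.+ i)
            lemma = ℕRing.solve-∀
        j≤M : j ℕ.≤ M
        j≤M = ℕₚ.≤-trans (ℕₚ.m≤m+n j i) (ℕₚ.≤-trans (ℕₚ.≤-reflexive j+i≡k) (ℕₚ.<⇒≤ k<M))
        diff : + (M ℕ.∸ j) - + suc i ≡ + M - + suc k
        diff = trans (cong (_- + suc i) (trans (sym (ℤₚ.⊖-≥ j≤M)) (sym (ℤₚ.m-n≡m⊖n M j))))
          (trans (lemma (+ M) (+ j) (+ i)) (cong (λ r → + M - + suc r) j+i≡k))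
          where
          lemma : ∀ m j i → (m - j) - (1ℤ + i) ≡ m - (1ℤ + (j + i))
          lemma = solve-∀
        lemma₀ : ∀ q t b → (q * t) * b ≡ t * (q * b)
        lemma₀ = solve-∀
        B-∣ : P ^ κ ∣ P ^ s * B
        B-∣ = coprime-∣ κ P∤t (subst (P ^ κ ∣_)
          (trans (sym ([k+1]*nC[k+1]≡[n-k]*nCk (M ℕ.∸ j) (suc i))) (trans (cong (_* B) eq) (lemma₀ (P ^ s) t B)))
          (∣m⇒∣m*n (+ ((M ℕ.∸ j) C suc i)) (subst (P ^ κ ∣_) (sym diff) dM)))
        go : P ^ (n ℕ.+ n ℕ.+ s) ∣ h ^ (2 ℕ.+ i) → P ^ (n ℕ.+ n) * P ^ κ ∣ h ^ (2 ℕ.+ i) * B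
        go (divides y e) = subst (P ^ (n ℕ.+ n) * P ^ κ ∣_)
          (trans (lemma (P ^ (n ℕ.+ n)) (P ^ s) B y)
            (cong (_* B) (sym (trans e (cong (y *_) (ℤₚ.^-distribˡ-+-* P (n ℕ.+ n) s))))))
          (∣n⇒∣m*n y (*-monoʳ-∣ (P ^ (n ℕ.+ n)) B-∣))
          where
          lemma : ∀ q r b y → y * (q * (r * b)) ≡ y * (q * r) * b
          lemma = solve-∀

      -- In `esym-odd` the product has valuation n + κ + w and the remainder is divisible by
      -- p^(2n+κ), a strictly higher power since w < n. So twice the target has the valuation of the
      -- product, and 2 is prime to p.
      esym-odd-val : ∀ {n κ w} j k N → suc (suc k) ≡ 2 ℕ.* j ℕ.+ 1 → suc (suc k) ℕ.≤ N →
        HasVal n (+ N) → HasVal κ (+ N - + suc (suc k)) → HasVal w (esym (suc k) N 0ℤ) → w ℕ.< n →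
        HasVal (n ℕ.+ κ ℕ.+ w) (esym (suc (suc k)) N 0ℤ)
      esym-odd-val {n} {κ} {w} j k (suc M) odd (s≤s k<M) valN valκ valw w<n = HasVal-cancel P∤2
        (subst (HasVal (n ℕ.+ κ ℕ.+ w)) (lemma A _)
          (HasVal-+ (HasVal-* (HasVal-* valN valκ) valw)
            (∣m⇒∣-m (subst (P ^ suc (n ℕ.+ κ ℕ.+ w) ∣_) (sym (esym-odd j k M odd k<M))
              (∣-trans (^-mono-∣ P exponent)
                (antidiag-∣ _ k (λ j i e → taylorTerm-∣ M k j i (- (+ suc M)) (ℕₚ.≤-trans (s≤s z≤n) w<n) k<M e
                  (∣m⇒∣-m (HasVal-∣ valN)) (subst (P ^ κ ∣_) (diff (+ M) (+ suc k)) (HasVal-∣ valκ)))))))))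
        where
        A = (+ suc M * (+ suc M - + suc (suc k))) * esym (suc k) (suc M) 0ℤ
        lemma : ∀ a b → a + - (a - b) ≡ b
        lemma = solve-∀
        diff : ∀ m k → (1ℤ + m) - (1ℤ + k) ≡ m - k
        diff = solve-∀
        exponent : suc (n ℕ.+ κ ℕ.+ w) ℕ.≤ n ℕ.+ n ℕ.+ κ
        exponent = subst₂ ℕ._≤_ (lemma₁ n κ w) (lemma₂ n κ) (ℕₚ.+-monoʳ-≤ (n ℕ.+ κ) w<n)
          where
          lemma₁ : ∀ n κ w → n ℕ.+ κ ℕ.+ suc w ≡ suc (n ℕ.+ κ ℕ.+ w)
          lemma₁ = ℕRing.solve-∀
          lemma₂ : ∀ n κ → n ℕ.+ κ ℕ.+ n ≡ n ℕ.+ n ℕ.+ κ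
          lemma₂ = ℕRing.solve-∀

      -- Specialisation to N = a p^n and return to Stirling numbers.

      module _ {a : ℕ} (p∤a : ¬ p ℕ∣.∣ a) where

        HasVal-a*p^n : ∀ n → HasVal n (+ (a ℕ.* p ℕ.^ n))
        HasVal-a*p^n n = hasVal (+ a)
          (trans (ℤₚ.pos-* a (p ℕ.^ n)) (trans (cong (+ a *_) (pos-^ p n)) (ℤₚ.*-comm (+ a) (P ^ n))))
          (λ d → p∤a (∣⇒∣ᵤ d))

        -- Each step raises both the exponent of p in N and the valuation by 1, so the hypothesis w
        -- < n of `esym-val-step` is preserved.
        esym-even-val : ∀ k n w → (2 ℕ.+ k) ℕ.* (2 ℕ.+ k) ℕ.< p ℕ.^ n → w ℕ.< n →
          HasVal w (esym (2 ℕ.+ k) (a ℕ.* p ℕ.^ n) 0ℤ) →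
          ∀ d → HasVal (d ℕ.+ w) (esym (2 ℕ.+ k) (a ℕ.* p ℕ.^ (d ℕ.+ n)) 0ℤ)
        esym-even-val k n w lt w<n val zero    = val
        esym-even-val k n w lt w<n val (suc d) =
          subst (λ N → HasVal (suc d ℕ.+ w) (esym (2 ℕ.+ k) N 0ℤ)) (swap p a (p ℕ.^ (d ℕ.+ n)))
            (esym-val-step (a ℕ.* p ℕ.^ (d ℕ.+ n)) k (HasVal-∣ (HasVal-a*p^n (d ℕ.+ n)))
              (ℕₚ.<-≤-trans lt (ℕₚ.^-monoʳ-≤ p (ℕₚ.m≤n+m n d))) (ℕₚ.+-monoʳ-< d w<n)
              (esym-even-val k n w lt w<n val d))
          where
          swap : ∀ p a q → p ℕ.* (a ℕ.* q) ≡ a ℕ.* (p ℕ.* q)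
          swap = ℕRing.solve-∀

        -- At distance d the valuation is (d + n) + κ + (d + w). The gain of 2 per step has one part
        -- from N and one from the degree below; κ, the valuation of 3 + k, stays fixed.
        stirling1-vals : ∀ {k n w} j → 1 ℕ.≤ a → 3 ℕ.+ k ≡ 2 ℕ.* j ℕ.+ 1 → (2 ℕ.+ k) ℕ.^ 3 ℕ.* a ℕ.< p ℕ.^ n →
          w ℕ.< n → IsVal p (stirling1 (a ℕ.* p ℕ.^ n) (a ℕ.* p ℕ.^ n ℕ.∸ (2 ℕ.+ k))) w →
          ∃ λ v → ∀ d →
            IsVal p (stirling1 (a ℕ.* p ℕ.^ (d ℕ.+ n)) (a ℕ.* p ℕ.^ (d ℕ.+ n) ℕ.∸ (3 ℕ.+ k))) (v ℕ.+ 2 ℕ.* d)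
        stirling1-vals {k} {n} {w} j 1≤a odd lt w<n val with suc-val (2 ℕ.+ k)
        ... | κ , p^κ≤k , valκ = n ℕ.+ κ ℕ.+ w , λ d → HasVal⇒IsVal (subst₂ HasVal (rearrange d n κ w)
                (sym (stirling1-∸≡esym (N d) (3 ℕ.+ k) (k≤N d)))
                (esym-odd-val j (suc k) (N d) odd (k≤N d) (HasVal-a*p^n (d ℕ.+ n)) (N-k-val d)
                  (esym-even-val k n w m²<p^n w<n val₀ d) (ℕₚ.+-monoʳ-< d w<n)))
          where
          m = 2 ℕ.+ k
          N : ℕ → ℕ
          N d = a ℕ.* p ℕ.^ (d ℕ.+ n)
          rearrange : ∀ d n κ w → d ℕ.+ n ℕ.+ κ ℕ.+ (d ℕ.+ w) ≡ n ℕ.+ κ ℕ.+ w ℕ.+ 2 ℕ.* d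
          rearrange = ℕRing.solve-∀
          -- From m² ≤ m³ a, as m and a are at least 1.
          m²<p^n : m ℕ.* m ℕ.< p ℕ.^ n
          m²<p^n = ℕₚ.≤-<-trans (subst₂ ℕ._≤_ (cong (m ℕ.*_) (ℕₚ.*-identityʳ m)) (expand m a)
            (ℕₚ.*-monoʳ-≤ m (ℕₚ.*-monoʳ-≤ m (ℕₚ.*-mono-≤ {1} {m} (s≤s z≤n) 1≤a)))) lt
            where
            expand : ∀ m a → m ℕ.* (m ℕ.* (m ℕ.* a)) ≡ m ℕ.* (m ℕ.* (m ℕ.* 1)) ℕ.* a
            expand = ℕRing.solve-∀
          k<p^n : 3 ℕ.+ k ℕ.< p ℕ.^ n
          k<p^n = ℕₚ.≤-<-trans (subst (ℕ._≤ m ℕ.* m) (ℕₚ.+-comm m 1) (ℕₚ.+-monoʳ-≤ m (s≤s z≤n))) m²<p^n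
          k<p^[d+n] : ∀ d → 3 ℕ.+ k ℕ.< p ℕ.^ (d ℕ.+ n)
          k<p^[d+n] d = ℕₚ.<-≤-trans k<p^n (ℕₚ.^-monoʳ-≤ p (ℕₚ.m≤n+m n d))
          k≤N : ∀ d → 3 ℕ.+ k ℕ.≤ N d
          k≤N d = ℕₚ.≤-trans (ℕₚ.<⇒≤ (k<p^[d+n] d)) (ℕₚ.m≤n*m (p ℕ.^ (d ℕ.+ n)) a {{ℕ.>-nonZero 1≤a}})
          -- Since p^κ ≤ 3 + k < p^(d+n), N is divisible by a higher power of p than 3 + k, so the
          -- difference keeps the valuation κ.
          N-k-val : ∀ d → HasVal κ (+ N d - + (3 ℕ.+ k))
          N-k-val d = subst (HasVal κ) (ℤₚ.+-comm (- (+ (3 ℕ.+ k))) (+ N d)) (HasVal-+ (HasVal-neg valκ)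
            (∣-trans (^-mono-∣ P {suc κ} {d ℕ.+ n} (^-cancel-< {κ} {d ℕ.+ n} (ℕₚ.≤-<-trans p^κ≤k (k<p^[d+n] d)))) (HasVal-∣ (HasVal-a*p^n (d ℕ.+ n)))))
          val₀ : HasVal w (esym m (N 0) 0ℤ)
          val₀ = subst (HasVal w) (stirling1-∸≡esym (N 0) m (ℕₚ.≤-trans (ℕₚ.n≤1+n m) (k≤N 0))) (IsVal⇒HasVal val)

-- The theorem, with the logarithmic bound on n₁ in exponential form.

open import Data.Nat using (ℕ; suc; _+_; _*_; _∸_; _^_; _≤_; _<_; s≤s)

theorem1p5 : (p a k n₁ : ℕ) → Prime p → 5 ≤ p → 1 ≤ a → gcd a p ≡ 1
    → 3 ≤ k → (∃ λ j → k ≡ 2 * j + 1)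
    → 1 ≤ n₁ → (k ∸ 1) ^ 3 * a < p ^ n₁
    → (∃ λ w → IsVal p (stirling1 (a * p ^ n₁) (a * p ^ n₁ ∸ (k ∸ 1))) w × w < n₁)
    → ((n : ℕ) → n₁ ≤ n → ∃ λ v →
         IsVal p (stirling1 (a * p ^ n) (a * p ^ n ∸ k)) v
         × IsVal p (stirling1 (a * p ^ suc n) (a * p ^ suc n ∸ k)) (v + 2))
      × (∃ λ v₁ → IsVal p (stirling1 (a * p ^ n₁) (a * p ^ n₁ ∸ k)) v₁
         × ((n : ℕ) → n₁ ≤ n
            → IsVal p (stirling1 (a * p ^ n) (a * p ^ n ∸ k)) (v₁ + 2 * (n ∸ n₁))))
-- Matching on 3 ≤ k exposes k as a triple successor, the shape used in `stirling1-vals`. Both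
-- claims are then read off from the single closed form `at`.
theorem1p5 p a k n₁ p-prime 5≤p 1≤a gcd≡1 (s≤s (s≤s (s≤s _))) (j , odd) 1≤n₁ lt (w , val , w<n₁) =
  (λ n n₁≤n → v₁ + 2 * (n ∸ n₁) , at n n₁≤n , subst (IsVal p _) (step n n₁≤n) (at (suc n) (ℕₚ.m≤n⇒m≤1+n n₁≤n))) ,
  v₁ , subst (IsVal p _) (ℕₚ.+-identityʳ v₁) (vals 0) , at
  where
  3≤p : 3 ≤ p
  3≤p = ℕₚ.≤-trans (ℕₚ.m≤m+n 3 2) 5≤p

  p∤a : ¬ p ℕ∣.∣ a
  p∤a p∣a = ℕₚ.<⇒≱ 3≤p (ℕₚ.≤-trans (ℕ∣.∣⇒≤ p∣1) (ℕₚ.n≤1+n 1))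
    where
    p∣1 : p ℕ∣.∣ 1
    p∣1 = subst (p ℕ∣.∣_) gcd≡1 (gcd-greatest p∣a ℕ∣.∣-refl)

  v₁,vals = stirling1-vals p-prime 3≤p p∤a j 1≤a odd lt w<n₁ val
  v₁ = proj₁ v₁,vals
  vals = proj₂ v₁,vals

  at : ∀ n → n₁ ≤ n → IsVal p (stirling1 (a * p ^ n) (a * p ^ n ∸ k)) (v₁ + 2 * (n ∸ n₁))
  at n n₁≤n = subst (λ m → IsVal p (stirling1 (a * p ^ m) (a * p ^ m ∸ k)) (v₁ + 2 * (n ∸ n₁)))
    (ℕₚ.m∸n+n≡m n₁≤n) (vals (n ∸ n₁))

  step : ∀ n → n₁ ≤ n → v₁ + 2 * (suc n ∸ n₁) ≡ v₁ + 2 * (n ∸ n₁) + 2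
  step n n₁≤n = begin
    v₁ + 2 * (suc n ∸ n₁)      ≡⟨ cong (λ d → v₁ + 2 * d) (ℕₚ.+-∸-assoc 1 n₁≤n) ⟩
    v₁ + 2 * suc (n ∸ n₁)      ≡⟨ cong (v₁ +_) (trans (ℕₚ.*-suc 2 (n ∸ n₁)) (ℕₚ.+-comm 2 (2 * (n ∸ n₁)))) ⟩
    v₁ + (2 * (n ∸ n₁) + 2)    ≡⟨ ℕₚ.+-assoc v₁ (2 * (n ∸ n₁)) 2 ⟨
    v₁ + 2 * (n ∸ n₁) + 2      ∎
    where open ≡-Reasoning
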